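{- Let $n\ge 2$ be an integer. The poset $\mathrm{Poset}(\mathrm{PF}_{n,n})$ is irreducible as a direct product of posets: it is not isomorphic to a direct product $P\times Q$ of two posets $P$ and $Q$ each having more than one element.
   Context: Write $[n]=\{1,\dots,n\}$. A parking function of length $n$ is an $n$-tuple $(a_1,\dots,a_n)$ of positive integers whose weakly increasing rearrangement $b_1\le\dots\le b_n$ satisfies $b_i\le i$ for all $i$; $\mathrm{PF}_n$ is the set of these. For $n\ge 2$, $\mathrm{PF}_{n,n}$ is the set of $a\in\mathrm{PF}_n$ such that $n$ is not an entry of $a$. $\mathrm{NC}_m$ is the lattice of noncrossing partitions of $[m]$ (partitions for which, placing $1,\dots,m$ in clockwise order on a circle, the convex hulls of the blocks are pairwise disjoint), ordered by refinement, with the finer partition being smaller. Each covering relation $\sigma<\tau$ in $\mathrm{NC}_{n+1}$ merges two blocks $B_1,B_2$ of $\sigma$ into one block $B=B_1\cup B_2$ of $\tau$; name them so that $\min B\in B_1$, and label the covering relation by the largest element of $B_1$ that is less than every element of $B_2$. Reading the labels of a maximal chain of $\mathrm{NC}_{n+1}$ from bottom to top gives a parking function of length $n$, and this is a (known) bijection from maximal chains of $\mathrm{NC}_{n+1}$ to $\mathrm{PF}_n$. $\mathrm{Poset}(\mathrm{PF}_{n,n})$ is the poset whose Hasse diagram is the union of the maximal chains of $\mathrm{NC}_{n+1}$ corresponding to elements of $\mathrm{PF}_{n,n}$: its elements are the noncrossing partitions lying on at least one of these chains, and its order is the reflexive-transitive closure of the covering relations occurring in these chains (it need not be an induced subposet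 of $\mathrm{NC}_{n+1}$). -}

module Defs where

open import Level using (Level; _⊔_; 0ℓ) renaming (suc to lsuc)
open import Data.Fin as Fin using (Fin; toℕ)
import Data.Fin.Properties as Finₚ
open import Data.Fin.Subset using (Subset; _∈_; _⊆_; _∪_; ⊤; ⁅_⁆; Nonempty)
open import Data.Fin.Subset.Properties
  using (∈⊤; x∈⁅x⁆; x∈⁅y⁆⇒x≡y; ⊆-antisym)
open import Data.List.Base using (List; []; _∷_; _++_; length; lookup)
open import Data.List.Membership.Propositional using () renaming (_∉_ to _∉ₗ_)
open import Data.List.Relation.Binary.Permutation.Propositional using (_↭_)
open import Data.List.Relation.Unary.All using (All)
open import Data.Nat.Base using (ℕ; suc; _≤_)
open import Data.Nat.Properties using (≤-totalOrder)
open import Data.List.Relation.Unary.Sorted.TotalOrder ≤-totalOrder using (Sorted)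
open import Data.Product.Base using (Σ; ∃; ∃₂; _×_; _,_; proj₁; proj₂)
open import Data.Sum.Base using (_⊎_; inj₁; inj₂)
open import Function.Base using (id; _∘_; _on_)
open import Relation.Binary.Bundles using (Poset)
open import Relation.Binary.Core using (Rel)
open import Relation.Binary.Construct.Closure.ReflexiveTransitive
  using (Star; ε; _◅_; _◅◅_)
import Relation.Binary.Construct.NonStrictToStrict as ToStrict
open import Relation.Binary.Morphism.Structures using (IsOrderIsomorphism)
open import Relation.Binary.PropositionalEquality
  using (_≡_; _≢_; refl; sym; trans; subst)
open import Relation.Nullary.Negation using (¬_; contradiction)
open import Relation.Unary using (Pred; _≐_)

private
  variable
    a b ℓ₁ ℓ₂ ℓ₃ ℓ₄ : Level
    m : ℕ

-- Tuples are lists of the prescribed length.  The index i of `lookup`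
-- starts at 0, so the usual condition bᵢ ≤ i reads lookup b i ≤ suc i.
record IsParkingFunction (n : ℕ) (as : List ℕ) : Set where
  field
    length≡n      : length as ≡ n
    positive      : All (1 ≤_) as
    rearrangement : ∃ λ bs → bs ↭ as × Sorted bs ×
                      (∀ i → lookup bs i ≤ suc (toℕ i))

PF : (n : ℕ) → Pred (List ℕ) 0ℓ
PF = IsParkingFunction

PFₙₙ : (n : ℕ) → Pred (List ℕ) 0ℓ
PFₙₙ n as = PF n as × n ∉ₗ as

-- The integer k ∈ [m] is the element of Fin m with toℕ equal to k - 1.
record Partition (m : ℕ) : Set₁ where
  field
    IsBlock  : Pred (Subset m) 0ℓ
    nonempty : ∀ {B} → IsBlock B → Nonempty B
    covers   : ∀ i → ∃ λ B → IsBlock B × i ∈ B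
    disjoint : ∀ {B C i} → IsBlock B → IsBlock C → i ∈ B → i ∈ C → B ≡ C

-- For points in convex position, the hulls of two disjoint blocks meet
-- exactly when a chord of one crosses a chord of the other, i.e. when
-- there are a < b < c < d with a, c in one block and b, d in the other.
record NC (m : ℕ) : Set₁ where
  field
    partition : Partition m
  open Partition partition public
  field
    noncrossing : ∀ {B C a b c d} → IsBlock B → IsBlock C →
                  a Fin.< b → b Fin.< c → c Fin.< d →
                  a ∈ B → c ∈ B → b ∈ C → d ∈ C → B ≡ C

open NC using (IsBlock)

infix 4 _≈_ _⊑_ _⊏_ _⋖_ _⋖[_]_

_≈_ : Rel (NC m) 0ℓ
σ ≈ τ = IsBlock σ ≐ IsBlock τ

_⊑_ : Rel (NC m) 0ℓ
σ ⊑ τ = ∀ {B} → IsBlock σ B → ∃ λ C → IsBlock τ C × B ⊆ C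

_⊏_ : Rel (NC m) 0ℓ
_⊏_ = ToStrict._<_ _≈_ _⊑_

_⋖_ : Rel (NC m) (lsuc 0ℓ)
σ ⋖ τ = σ ⊏ τ × (∀ ρ → ¬ (σ ⊏ ρ × ρ ⊏ τ))

⊑-reflexive : {σ τ : NC m} → σ ≈ τ → σ ⊑ τ
⊑-reflexive (f , _) {B} p = B , f p , id

⊑-trans : {σ τ υ : NC m} → σ ⊑ τ → τ ⊑ υ → σ ⊑ υ
⊑-trans f g p with f p
... | C , q , B⊆C with g q
...   | D , r , C⊆D = D , r , C⊆D ∘ B⊆C

⊑-antisym : {σ τ : NC m} → σ ⊑ τ → τ ⊑ σ → σ ≈ τ
⊑-antisym {σ = σ} {τ} f g = half {σ = σ} {τ} f g , half {σ = τ} {σ} g f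
  where
  half : {σ τ : NC m} → σ ⊑ τ → τ ⊑ σ → ∀ {B} → IsBlock σ B → IsBlock τ B
  half {σ = σ} {τ} f g {B} p with f p | NC.nonempty σ p
  ... | C , q , B⊆C | i , i∈B with g q
  ...   | B′ , p′ , C⊆B′ = subst (IsBlock τ) (⊆-antisym C⊆B B⊆C) q
    where
    C⊆B : C ⊆ B
    C⊆B = subst (C ⊆_) (sym (NC.disjoint σ p p′ i∈B (C⊆B′ (B⊆C i∈B)))) C⊆B′

0̂ : NC m
0̂ = record
  { partition = record
    { IsBlock  = λ B → ∃ λ i → B ≡ ⁅ i ⁆
    ; nonempty = λ { (i , refl) → i , x∈⁅x⁆ i }
    ; covers   = λ i → ⁅ i ⁆ , (i , refl) , x∈⁅x⁆ i
    ; disjoint = λ { (i , refl) (j , refl) p q →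
        subst (λ k → ⁅ i ⁆ ≡ ⁅ k ⁆)
              (trans (sym (x∈⁅y⁆⇒x≡y i p)) (x∈⁅y⁆⇒x≡y j q)) refl }
    }
  ; noncrossing = λ { (i , refl) _ a<b b<c _ a∈B c∈B _ _ →
      contradiction (Finₚ.<-trans a<b b<c)
        (Finₚ.<-irrefl (trans (x∈⁅y⁆⇒x≡y i a∈B) (sym (x∈⁅y⁆⇒x≡y i c∈B)))) }
  }

1̂ : NC (suc m)
1̂ = record
  { partition = record
    { IsBlock  = _≡ ⊤
    ; nonempty = λ { refl → Fin.zero , ∈⊤ }
    ; covers   = λ i → ⊤ , refl , ∈⊤
    ; disjoint = λ p q _ _ → trans p (sym q)
    }
  ; noncrossing = λ p q _ _ _ _ _ _ _ → trans p (sym q)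
  }

Below : Subset m → Pred (Fin m) 0ℓ
Below B i = ∀ {j} → j ∈ B → i Fin.< j

-- B₁ and B₂ are the merged blocks, min₁ is min (B₁ ∪ B₂), and max₁ is the
-- element whose value in [m] is the label.
record Merge (σ τ : NC m) (label : ℕ) : Set where
  field
    B₁ B₂     : Subset m
    B₁-block  : IsBlock σ B₁
    B₂-block  : IsBlock σ B₂
    B₁≢B₂     : B₁ ≢ B₂
    merged    : IsBlock τ (B₁ ∪ B₂)
    min₁      : Fin m
    min₁∈B₁   : min₁ ∈ B₁
    min₁-min  : ∀ {j} → j ∈ B₁ ∪ B₂ → min₁ Fin.≤ j
    max₁      : Fin m
    max₁∈B₁   : max₁ ∈ B₁
    max₁<B₂   : Below B₂ max₁
    max₁-max  : ∀ {i} → i ∈ B₁ → Below B₂ i → i Fin.≤ max₁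
    label≡    : label ≡ suc (toℕ max₁)

_⋖[_]_ : NC m → ℕ → NC m → Set₁
σ ⋖[ k ] τ = σ ⋖ τ × Merge σ τ k

-- Saturated chains, indexed by endpoints and by the word of labels read
-- from bottom to top.  Those from 0̂ to 1̂ are the maximal chains.
data Chain {m : ℕ} : NC m → NC m → List ℕ → Set₁ where
  nil  : ∀ {σ τ} → σ ≈ τ → Chain σ τ []
  cons : ∀ {σ ρ τ k ks} → σ ⋖[ k ] ρ → Chain ρ τ ks → Chain σ τ (k ∷ ks)

-- S selects the maximal chains by their label words.
module _ (n : ℕ) (S : Pred (List ℕ) 0ℓ) where

  -- A maximal chain through σ is given by its parts below and above σ.
  OnChain : Pred (NC (suc n)) (lsuc 0ℓ)
  OnChain σ = ∃₂ λ ks ls → Chain 0̂ σ ks × Chain σ 1̂ ls × S (ks ++ ls)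

  ChainCover : Rel (NC (suc n)) (lsuc 0ℓ)
  ChainCover σ τ = ∃ λ ks → ∃₂ λ k ls →
    Chain 0̂ σ ks × σ ⋖[ k ] τ × Chain τ 1̂ ls × S (ks ++ k ∷ ls)

  Element : Set₁
  Element = Σ (NC (suc n)) OnChain

  -- `Star` is reflexive only for propositional equality; the steps along
  -- _≈_ make the closure reflexive for equality of partitions.
  Step : Rel Element (lsuc 0ℓ)
  Step (σ , _) (τ , _) = σ ≈ τ ⊎ ChainCover σ τ

  star⇒⊑ : ∀ {x y} → Star Step x y → proj₁ x ⊑ proj₁ y
  star⇒⊑ ε {B} p = B , p , id
  star⇒⊑ {σ , _} {υ , _} (_◅_ {j = τ , _} (inj₁ e) s) =
    ⊑-trans {σ = σ} {τ} {υ} (⊑-reflexive {σ = σ} {τ} e) (star⇒⊑ s)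
  star⇒⊑ {σ , _} {υ , _}
    (_◅_ {j = τ , _} (inj₂ (_ , _ , _ , _ , (((σ⊑τ , _) , _) , _) , _)) s) =
    ⊑-trans {σ = σ} {τ} {υ} σ⊑τ (star⇒⊑ s)

  chainPoset : Poset (lsuc 0ℓ) 0ℓ (lsuc 0ℓ)
  chainPoset = record
    { Carrier = Element
    ; _≈_     = _≈_ on proj₁
    ; _≤_     = Star Step
    ; isPartialOrder = record
      { isPreorder = record
        { isEquivalence = record
          { refl  = id , id
          ; sym   = λ (f , g) → g , f
          ; trans = λ (f , g) (f′ , g′) → f′ ∘ f , g ∘ g′
          }
        ; reflexive = λ e → inj₁ e ◅ ε
        ; trans     = _◅◅_
        }
      ; antisym = λ {x} {y} s t →
          ⊑-antisym {σ = proj₁ x} {proj₁ y} (star⇒⊑ s) (star⇒⊑ t)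
      }
    }

PosetPFₙₙ : ℕ → Poset (lsuc 0ℓ) 0ℓ (lsuc 0ℓ)
PosetPFₙₙ n = chainPoset n (PFₙₙ n)

infix 4 _≅_

_≅_ : Poset a ℓ₁ ℓ₂ → Poset b ℓ₃ ℓ₄ → Set (a ⊔ b ⊔ ℓ₁ ⊔ ℓ₂ ⊔ ℓ₃ ⊔ ℓ₄)
P ≅ Q = ∃ (IsOrderIsomorphism P._≈_ Q._≈_ P._≤_ Q._≤_)
  where module P = Poset P
        module Q = Poset Q

MoreThanOneElement : Poset a ℓ₁ ℓ₂ → Set (a ⊔ ℓ₁)
MoreThanOneElement P = ∃₂ λ x y → ¬ (x P.≈ y)
  where module P = Poset P

{-# OPTIONS --safe #-}
module Submission where

-- In a product of bounded posets the elements u = (1 , 0) and v = (0 , 1) are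
-- such that every atom is below u or v and every coatom is above u or v.
-- Only partitions with a single nontrivial block are needed to exclude this.
-- In the notation of [n + 1], let n ≥ 3.  The coatom {1} | rest is above u or
-- v, say v, so 1 is isolated in v.  For 2 ≤ k ≤ n - 1 the atom {1 , k} is then
-- below u, hence the coatom {k} | rest is not above u, so it is above v and k
-- is isolated in v.  Hence v joins at most n and n + 1, and a chain through v
-- would start with the label n.  For n = 2 the poset is a chain of three
-- elements, so u and v would coincide.

open import Defs
open import Data.Empty using (⊥)
open import Data.Fin as Fin using (Fin; zero; suc; toℕ; fromℕ<; inject₁)
import Data.Fin.Properties as Finₚ
open import Data.Fin.Subset using (Subset; _∈_; _∉_; _⊆_; _∪_; ⊤; ∁; ⁅_⁆; Nonempty)
open import Data.Fin.Subset.Properties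
  using (∈⊤; x∈⁅x⁆; x∈⁅y⁆⇒x≡y; x≢y⇒x∉⁅y⁆; ⊆-antisym; _∈?_; x∈p∪q⁺; x∈p∪q⁻;
         x∈∁p⇒x∉p; x∉p⇒x∈∁p; p∪∁p≡⊤; ∪-inverseˡ)
open import Data.List.Base using (List; []; _∷_; _++_; [_]; length; lookup; replicate)
open import Data.List.Properties using (++-assoc; ++-identityʳ; length-++; length-replicate)
import Data.List.Membership.Propositional as List
open import Data.List.Membership.Propositional.Properties using (∈-++⁺ˡ; ∈-++⁺ʳ)
open import Data.List.Relation.Binary.Permutation.Propositional using (_↭_; ↭-refl; prep)
open import Data.List.Relation.Binary.Permutation.Propositional.Properties
  using (↭-length; All-resp-↭; ++-comm)
open import Data.List.Relation.Unary.All using (All; []; _∷_)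
import Data.List.Relation.Unary.All.Properties as All
open import Data.List.Relation.Unary.Any using (here)
open import Data.Nat.Base using (ℕ; zero; suc; _+_; _∸_; _≤_; _<_; z≤n; s≤s)
import Data.Nat.Properties as ℕ
open import Data.Nat.Properties using (_≤?_)
open import Data.List.Relation.Unary.Linked using ([]; [-]; _∷_)
open import Data.List.Relation.Unary.Sorted.TotalOrder ℕ.≤-totalOrder using (Sorted)
open import Data.Product.Base using (∃; ∃₂; _×_; _,_; proj₁; proj₂; swap)
open import Data.Product.Relation.Binary.Pointwise.NonDependent using (×-poset)
open import Data.Sum.Base as Sum using (_⊎_; inj₁; inj₂)
open import Data.Vec.Base using (tabulate)
open import Data.Vec.Properties using (lookup∘tabulate; lookup⇒[]=; []=⇒lookup)
open import Function.Base using (id; _∘_)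
open import Level using (0ℓ; _⊔_)
open import Relation.Binary.Bundles using (Poset)
open import Relation.Binary.Construct.Closure.ReflexiveTransitive using (Star; ε; _◅_)
open import Relation.Binary.Definitions using (tri<; tri≈; tri>)
open import Relation.Binary.Morphism.Structures using (IsOrderIsomorphism)
open import Relation.Binary.PropositionalEquality
  using (_≡_; _≢_; refl; sym; trans; cong; cong₂; subst; subst₂)
open import Relation.Nullary.Decidable
  using (Dec; yes; no; does; dec-true; dec-false; decidable-stable)
open import Relation.Nullary.Negation using (¬_; contradiction)
open import Relation.Unary using (Pred)

open NC using (IsBlock)

private
  variable
    m : ℕ

-- Singletons and their complements, in terms of the values of points.

∈⁅⁆⇒toℕ≡ : {x i : Fin m} → i ∈ ⁅ x ⁆ → toℕ i ≡ toℕ x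
∈⁅⁆⇒toℕ≡ {x = x} i∈ = cong toℕ (x∈⁅y⁆⇒x≡y x i∈)

toℕ≡⇒∈⁅⁆ : {x i : Fin m} → toℕ i ≡ toℕ x → i ∈ ⁅ x ⁆
toℕ≡⇒∈⁅⁆ {x = x} e = subst (_∈ ⁅ x ⁆) (sym (Finₚ.toℕ-injective e)) (x∈⁅x⁆ x)

toℕ≢⇒∈∁⁅⁆ : (x : Fin m) {i : Fin m} → toℕ i ≢ toℕ x → i ∈ ∁ ⁅ x ⁆
toℕ≢⇒∈∁⁅⁆ x ne = x∉p⇒x∈∁p (ne ∘ ∈⁅⁆⇒toℕ≡)

∈∁⁅⁆⇒toℕ≢ : {x i : Fin m} → i ∈ ∁ ⁅ x ⁆ → toℕ i ≢ toℕ x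
∈∁⁅⁆⇒toℕ≢ i∈ e = x∈∁p⇒x∉p i∈ (toℕ≡⇒∈⁅⁆ e)

-- Partitions as equivalence relations.

Same : NC m → Fin m → Fin m → Set
Same σ i j = ∃ λ B → IsBlock σ B × i ∈ B × j ∈ B

Same-refl : (σ : NC m) (i : Fin m) → Same σ i i
Same-refl σ i with NC.covers σ i
... | B , p , i∈B = B , p , i∈B , i∈B

Same-sym : (σ : NC m) {i j : Fin m} → Same σ i j → Same σ j i
Same-sym σ (B , p , i∈B , j∈B) = B , p , j∈B , i∈B

Same-trans : (σ : NC m) {i j k : Fin m} → Same σ i j → Same σ j k → Same σ i k
Same-trans σ {k = k} (B , p , i∈B , j∈B) (C , q , j∈C , k∈C) =
  B , p , i∈B , subst (k ∈_) (NC.disjoint σ q p j∈C j∈B) k∈C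

-- `covers` yields the block of `i`, and membership in a subset is decidable, so the case split in
-- `between` is constructive.
Same? : (σ : NC m) (i j : Fin m) → Dec (Same σ i j)
Same? σ i j with NC.covers σ i
... | B , p , i∈B with j ∈? B
...   | yes j∈B = yes (B , p , i∈B , j∈B)
...   | no  j∉B = no λ { (C , q , i∈C , j∈C) →
          j∉B (subst (j ∈_) (NC.disjoint σ q p i∈C i∈B) j∈C) }

⊑⇒Same : (σ τ : NC m) → σ ⊑ τ → ∀ {i j} → Same σ i j → Same τ i j
⊑⇒Same σ τ σ⊑τ (B , p , i∈B , j∈B) with σ⊑τ p
... | C , q , B⊆C = C , q , B⊆C i∈B , B⊆C j∈B

Same⇒⊑ : (σ τ : NC m) → (∀ {i j} → Same σ i j → Same τ i j) → σ ⊑ τ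
Same⇒⊑ σ τ f {B} p with NC.nonempty σ p
... | i , i∈B with NC.covers τ i
...   | C , q , i∈C = C , q , B⊆C
  where
  B⊆C : B ⊆ C
  B⊆C {j} j∈B with f (B , p , i∈B , j∈B)
  ... | D , r , i∈D , j∈D = subst (j ∈_) (NC.disjoint τ r q i∈D i∈C) j∈D

≈-sym : (σ τ : NC m) → σ ≈ τ → τ ≈ σ
≈-sym _ _ = swap

≈-trans : (σ τ υ : NC m) → σ ≈ τ → τ ≈ υ → σ ≈ υ
≈-trans _ _ _ (f , g) (f′ , g′) = f′ ∘ f , g ∘ g′

0̂⊑ : (σ : NC m) → 0̂ ⊑ σ
0̂⊑ σ {B} (i , refl) with NC.covers σ i
... | C , q , i∈C = C , q , λ j∈ → subst (_∈ C) (sym (x∈⁅y⁆⇒x≡y i j∈)) i∈C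

⊑1̂ : (σ : NC (suc m)) → σ ⊑ 1̂
⊑1̂ σ p = ⊤ , refl , λ _ → ∈⊤

-- Partitions with at most one nontrivial block.

-- If `S` is empty or a singleton, the result is `0̂`; `Nonempty S` keeps the empty set from being a
-- block. A crossing would take two blocks with two points each, so none can occur.
single : Subset m → NC m
single S = record
  { partition = record
    { IsBlock  = λ B → (B ≡ S × Nonempty S) ⊎ (∃ λ i → i ∉ S × B ≡ ⁅ i ⁆)
    ; nonempty = λ { (inj₁ (refl , ne)) → ne
                   ; (inj₂ (i , _ , refl)) → i , x∈⁅x⁆ i }
    ; covers   = cover
    ; disjoint = disj
    }
  ; noncrossing = λ
    { (inj₁ (refl , _)) (inj₁ (refl , _)) _ _ _ _ _ _ _ → refl
    ; (inj₂ (i , _ , refl)) _ a<b b<c _ a∈ c∈ _ _ →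
        contradiction (Finₚ.<-trans a<b b<c)
          (Finₚ.<-irrefl (trans (x∈⁅y⁆⇒x≡y i a∈) (sym (x∈⁅y⁆⇒x≡y i c∈))))
    ; _ (inj₂ (i , _ , refl)) _ b<c c<d _ _ b∈ d∈ →
        contradiction (Finₚ.<-trans b<c c<d)
          (Finₚ.<-irrefl (trans (x∈⁅y⁆⇒x≡y i b∈) (sym (x∈⁅y⁆⇒x≡y i d∈))))
    }
  }
  where
  Block : Subset _ → Set
  Block B = (B ≡ S × Nonempty S) ⊎ (∃ λ i → i ∉ S × B ≡ ⁅ i ⁆)

  cover : ∀ i → ∃ λ B → Block B × i ∈ B
  cover i with i ∈? S
  ... | yes i∈S = S , inj₁ (refl , i , i∈S) , i∈S
  ... | no  i∉S = ⁅ i ⁆ , inj₂ (i , i∉S , refl) , x∈⁅x⁆ i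

  disj : ∀ {B C i} → Block B → Block C → i ∈ B → i ∈ C → B ≡ C
  disj (inj₁ (refl , _)) (inj₁ (refl , _)) _ _ = refl
  disj (inj₁ (refl , _)) (inj₂ (k , k∉S , refl)) i∈ i∈′ =
    contradiction (subst (_∈ S) (x∈⁅y⁆⇒x≡y k i∈′) i∈) k∉S
  disj (inj₂ (k , k∉S , refl)) (inj₁ (refl , _)) i∈ i∈′ =
    contradiction (subst (_∈ S) (x∈⁅y⁆⇒x≡y k i∈) i∈′) k∉S
  disj (inj₂ (k , _ , refl)) (inj₂ (l , _ , refl)) i∈ i∈′ =
    cong ⁅_⁆ (trans (sym (x∈⁅y⁆⇒x≡y k i∈)) (x∈⁅y⁆⇒x≡y l i∈′))

Same-single⁺ : (S : Subset m) {i j : Fin m} → i ∈ S → j ∈ S → Same (single S) i j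
Same-single⁺ S i∈S j∈S = S , inj₁ (refl , _ , i∈S) , i∈S , j∈S

Same-single⁻ : (S : Subset m) {i j : Fin m} →
               Same (single S) i j → i ≡ j ⊎ (i ∈ S × j ∈ S)
Same-single⁻ S (_ , inj₁ (refl , _) , i∈S , j∈S) = inj₂ (i∈S , j∈S)
Same-single⁻ S (_ , inj₂ (k , _ , refl) , i∈ , j∈) =
  inj₁ (trans (x∈⁅y⁆⇒x≡y k i∈) (sym (x∈⁅y⁆⇒x≡y k j∈)))

single⊑ : (S : Subset m) (σ : NC m) (s : Fin m) →
          (∀ {i} → i ∈ S → Same σ s i) → single S ⊑ σ
single⊑ S σ s f = Same⇒⊑ (single S) σ λ i~j → same (Same-single⁻ S i~j)
  where
  same : ∀ {i j} → i ≡ j ⊎ (i ∈ S × j ∈ S) → Same σ i j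
  same (inj₁ refl)        = Same-refl σ _
  same (inj₂ (i∈S , j∈S)) = Same-trans σ (Same-sym σ (f i∈S)) (f j∈S)

single-mono : {S T : Subset m} {s : Fin m} → s ∈ S → S ⊆ T → single S ⊑ single T
single-mono {S = S} {T} {s} s∈S S⊆T =
  single⊑ S (single T) s λ i∈S → Same-single⁺ T (S⊆T s∈S) (S⊆T i∈S)

0̂≈single⁅⁆ : (i : Fin m) → 0̂ ≈ single ⁅ i ⁆
0̂≈single⁅⁆ i = ⊑-antisym {σ = 0̂} {single ⁅ i ⁆} (0̂⊑ (single ⁅ i ⁆))
  (single⊑ ⁅ i ⁆ 0̂ i λ j∈ → subst (Same 0̂ i) (sym (x∈⁅y⁆⇒x≡y i j∈)) (Same-refl 0̂ i))

single⊤≈1̂ : single {suc m} ⊤ ≈ 1̂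
single⊤≈1̂ = ⊑-antisym {σ = single ⊤} {1̂} (⊑1̂ (single ⊤))
  (Same⇒⊑ 1̂ (single ⊤) λ _ → Same-single⁺ ⊤ ∈⊤ ∈⊤)

-- As `T` adds at most `x` to `S`, all depends on whether `ρ` joins `x` to `s`. If it does, the
-- block of `s` contains `T`. If not, a pair of distinct points joined by `ρ` but not inside `S`
-- would involve `x` and link it to `s`. Covers, atoms and coatoms all come from this.
between : (S T : Subset m) (s x : Fin m) → s ∈ S →
          (∀ {t} → t ∈ T → t ∈ S ⊎ t ≡ x) →
          (ρ : NC m) → single S ⊑ ρ → ρ ⊑ single T →
          ρ ≈ single S ⊎ ρ ≈ single T
between S T s x s∈S T⊆ ρ S⊑ρ ρ⊑T with Same? ρ s x
... | yes s~x = inj₂ (⊑-antisym {σ = ρ} {single T} ρ⊑T (single⊑ T ρ s T~))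
  where
  T~ : ∀ {i} → i ∈ T → Same ρ s i
  T~ i∈T with T⊆ i∈T
  ... | inj₁ i∈S  = ⊑⇒Same (single S) ρ S⊑ρ (Same-single⁺ S s∈S i∈S)
  ... | inj₂ refl = s~x
... | no s≁x = inj₁ (⊑-antisym {σ = ρ} {single S} (Same⇒⊑ ρ (single S) ρ⊑S) S⊑ρ)
  where
  S~ : ∀ {i} → i ∈ S → Same ρ s i
  S~ i∈S = ⊑⇒Same (single S) ρ S⊑ρ (Same-single⁺ S s∈S i∈S)

  ρ⊑S : ∀ {i j} → Same ρ i j → Same (single S) i j
  ρ⊑S {i} {j} i~j with Same-single⁻ T (⊑⇒Same ρ (single T) ρ⊑T i~j)
  ... | inj₁ refl = Same-refl (single S) i
  ... | inj₂ (i∈T , j∈T) with T⊆ i∈T | T⊆ j∈T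
  ...   | inj₁ i∈S  | inj₁ j∈S  = Same-single⁺ S i∈S j∈S
  ...   | inj₁ i∈S  | inj₂ refl = contradiction (Same-trans ρ (S~ i∈S) i~j) s≁x
  ...   | inj₂ refl | inj₁ j∈S  =
            contradiction (Same-trans ρ (S~ j∈S) (Same-sym ρ i~j)) s≁x
  ...   | inj₂ refl | inj₂ refl = Same-refl (single S) i

single-cover : (S T : Subset m) (s x : Fin m) → s ∈ S → x ∉ S → x ∈ T → S ⊆ T →
               (∀ {t} → t ∈ T → t ∈ S ⊎ t ≡ x) → single S ⋖ single T
single-cover S T s x s∈S x∉S x∈T S⊆T T⊆ =
  (single-mono s∈S S⊆T , S≉T) , no-between
  where
  S≉T : ¬ (single S ≈ single T)
  S≉T e with Same-single⁻ S (⊑⇒Same (single T) (single S)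
                     (⊑-reflexive {σ = single T} {single S} (≈-sym (single S) (single T) e))
                     {s} {x} (Same-single⁺ T (S⊆T s∈S) x∈T))
  ... | inj₁ refl      = x∉S s∈S
  ... | inj₂ (_ , x∈S) = x∉S x∈S

  no-between : ∀ ρ → ¬ (single S ⊏ ρ × ρ ⊏ single T)
  no-between ρ ((S⊑ρ , S≉ρ) , (ρ⊑T , ρ≉T)) with between S T s x s∈S T⊆ ρ S⊑ρ ρ⊑T
  ... | inj₁ e = S≉ρ (≈-sym ρ (single S) e)
  ... | inj₂ e = ρ≉T e

-- Transport and concatenation of chains.

-- One partition can be given by different block predicates, so covers have to be carried along `≈`.
-- The merged blocks, and with them the label, stay the same.
⋖-respˡ : (σ τ υ : NC m) {k : ℕ} → σ ≈ τ → τ ⋖[ k ] υ → σ ⋖[ k ] υ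
⋖-respˡ σ τ υ e (((τ⊑υ , τ≉υ) , no-between) , M) =
  ((⊑-trans {σ = σ} {τ} {υ} (⊑-reflexive {σ = σ} {τ} e) τ⊑υ
   , λ σ≈υ → τ≉υ (≈-trans τ σ υ (≈-sym σ τ e) σ≈υ))
  , λ { ρ ((σ⊑ρ , σ≉ρ) , ρ⊏υ) → no-between ρ
        ((⊑-trans {σ = τ} {σ} {ρ} (⊑-reflexive {σ = τ} {σ} (≈-sym σ τ e)) σ⊑ρ
         , λ τ≈ρ → σ≉ρ (≈-trans σ τ ρ e τ≈ρ)) , ρ⊏υ) })
  , record { Merge M ; B₁-block = proj₂ e (Merge.B₁-block M)
                     ; B₂-block = proj₂ e (Merge.B₂-block M) }

Chain-respˡ : (σ τ υ : NC m) {ks : List ℕ} → σ ≈ τ → Chain τ υ ks → Chain σ υ ks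
Chain-respˡ σ τ υ e (nil e′)             = nil (≈-trans σ τ υ e e′)
Chain-respˡ σ τ υ e (cons {ρ = ρ} c cs) = cons (⋖-respˡ σ τ ρ e c) cs

Chain-++ : (σ τ υ : NC m) {ks ls : List ℕ} →
           Chain σ τ ks → Chain τ υ ls → Chain σ υ (ks ++ ls)
Chain-++ σ τ υ (nil e)             ds = Chain-respˡ σ τ υ e ds
Chain-++ σ τ υ (cons {ρ = ρ} c cs) ds = cons c (Chain-++ ρ τ υ cs ds)

Chain⇒⊑ : (σ τ : NC m) {ks : List ℕ} → Chain σ τ ks → σ ⊑ τ
Chain⇒⊑ σ τ (nil e) = ⊑-reflexive {σ = σ} {τ} e
Chain⇒⊑ σ τ (cons {ρ = ρ} (((σ⊑ρ , _) , _) , _) cs) =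
  ⊑-trans {σ = σ} {ρ} {τ} σ⊑ρ (Chain⇒⊑ ρ τ cs)

-- Labelled covers and chains between one-block partitions.

-- By `gap`, no point of `S` lies after `y` up to and including `x`, so `y` is its largest point
-- below `x`. Points of `S` beyond `x` are allowed, which lets `x` enter in the middle of the block.
-- The minimum stays in `S` because `m₀` ≤ `y` < `x`.
append⋖ : (S : Subset m) (m₀ x y : Fin m) → m₀ ∈ S → (∀ {s} → s ∈ S → m₀ Fin.≤ s) →
          y ∈ S → y Fin.< x → (∀ {s} → s ∈ S → s Fin.≤ y ⊎ x Fin.< s) →
          single S ⋖[ suc (toℕ y) ] single (S ∪ ⁅ x ⁆)
append⋖ S m₀ x y m₀∈S m₀-min y∈S y<x gap =
  single-cover S (S ∪ ⁅ x ⁆) y x y∈S x∉S (x∈p∪q⁺ (inj₂ (x∈⁅x⁆ x))) (x∈p∪q⁺ ∘ inj₁)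
    (Sum.map₂ (x∈⁅y⁆⇒x≡y x) ∘ x∈p∪q⁻ S ⁅ x ⁆)
  , record
    { B₁ = S ; B₂ = ⁅ x ⁆
    ; B₁-block = inj₁ (refl , y , y∈S)
    ; B₂-block = inj₂ (x , x∉S , refl)
    ; B₁≢B₂ = λ e → x∉S (subst (x ∈_) (sym e) (x∈⁅x⁆ x))
    ; merged = inj₁ (refl , y , x∈p∪q⁺ (inj₁ y∈S))
    ; min₁ = m₀ ; min₁∈B₁ = m₀∈S
    ; min₁-min = m₀≤ ∘ x∈p∪q⁻ S ⁅ x ⁆
    ; max₁ = y ; max₁∈B₁ = y∈S
    ; max₁<B₂ = λ j∈ → subst (y Fin.<_) (sym (x∈⁅y⁆⇒x≡y x j∈)) y<x
    ; max₁-max = λ i∈S i<x → ≤y (i<x (x∈⁅x⁆ x)) (gap i∈S)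
    ; label≡ = refl
    }
  where
  x∉S : x ∉ S
  x∉S x∈S with gap x∈S
  ... | inj₁ x≤y = ℕ.<⇒≱ y<x x≤y
  ... | inj₂ x<x = ℕ.<-irrefl refl x<x

  m₀≤ : ∀ {j} → j ∈ S ⊎ j ∈ ⁅ x ⁆ → m₀ Fin.≤ j
  m₀≤ (inj₁ j∈S) = m₀-min j∈S
  m₀≤ (inj₂ j∈x) = subst (m₀ Fin.≤_) (sym (x∈⁅y⁆⇒x≡y x j∈x))
                     (ℕ.≤-trans (m₀-min y∈S) (ℕ.<⇒≤ y<x))

  ≤y : ∀ {i} → i Fin.< x → i Fin.≤ y ⊎ x Fin.< i → i Fin.≤ y
  ≤y i<x (inj₁ i≤y) = i≤y
  ≤y i<x (inj₂ x<i) = contradiction x<i (ℕ.<⇒≯ i<x)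

-- Here the singleton contains the minimum and takes the part of `B₁`, so `x` itself determines the
-- label.
prepend⋖ : (S : Subset m) (s x : Fin m) → s ∈ S → Below S x →
           single S ⋖[ suc (toℕ x) ] single (⁅ x ⁆ ∪ S)
prepend⋖ S s x s∈S x<S =
  single-cover S (⁅ x ⁆ ∪ S) s x s∈S x∉S (x∈p∪q⁺ (inj₁ (x∈⁅x⁆ x))) (x∈p∪q⁺ ∘ inj₂)
    (Sum.swap ∘ Sum.map₁ (x∈⁅y⁆⇒x≡y x) ∘ x∈p∪q⁻ ⁅ x ⁆ S)
  , record
    { B₁ = ⁅ x ⁆ ; B₂ = S
    ; B₁-block = inj₂ (x , x∉S , refl)
    ; B₂-block = inj₁ (refl , s , s∈S)
    ; B₁≢B₂ = λ e → x∉S (subst (x ∈_) e (x∈⁅x⁆ x))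
    ; merged = inj₁ (refl , s , x∈p∪q⁺ (inj₂ s∈S))
    ; min₁ = x ; min₁∈B₁ = x∈⁅x⁆ x
    ; min₁-min = x≤ ∘ x∈p∪q⁻ ⁅ x ⁆ S
    ; max₁ = x ; max₁∈B₁ = x∈⁅x⁆ x
    ; max₁<B₂ = x<S
    ; max₁-max = λ i∈ _ → ℕ.≤-reflexive (cong toℕ (x∈⁅y⁆⇒x≡y x i∈))
    ; label≡ = refl
    }
  where
  x∉S : x ∉ S
  x∉S x∈S = ℕ.<-irrefl refl (x<S x∈S)

  x≤ : ∀ {j} → j ∈ ⁅ x ⁆ ⊎ j ∈ S → x Fin.≤ j
  x≤ (inj₁ j∈x) = ℕ.≤-reflexive (cong toℕ (sym (x∈⁅y⁆⇒x≡y x j∈x)))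
  x≤ (inj₂ j∈S) = ℕ.<⇒≤ (x<S j∈S)

-- Absorbs the interval [l, l + d) in decreasing order, so that y stays the
-- largest element of the block below the next one absorbed.
absorb : ∀ {m} (S T : Subset m) (m₀ y : Fin m) (l d : ℕ) →
         m₀ ∈ S → (∀ {s} → s ∈ S → m₀ Fin.≤ s) →
         y ∈ S → toℕ y < l → l + d ≤ m →
         (∀ {s} → s ∈ S → s Fin.≤ y ⊎ l + d ≤ toℕ s) →
         S ⊆ T → (∀ {t} → l ≤ toℕ t → toℕ t < l + d → t ∈ T) →
         (∀ {t} → t ∈ T → t ∈ S ⊎ (l ≤ toℕ t × toℕ t < l + d)) →
         Chain (single S) (single T) (replicate d (suc (toℕ y)))
absorb S T m₀ y l zero m₀∈S m₀-min y∈S y<l l+d≤m gap S⊆T ⊆T T⊆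
  with ⊆-antisym S⊆T (λ t∈T → T⊆S (T⊆ t∈T))
  where
  T⊆S : ∀ {t} → t ∈ S ⊎ (l ≤ toℕ t × toℕ t < l + 0) → t ∈ S
  T⊆S (inj₁ t∈S)         = t∈S
  T⊆S (inj₂ (l≤t , t<l)) =
    contradiction l≤t (ℕ.<⇒≱ (subst (_ <_) (ℕ.+-identityʳ l) t<l))
... | refl = nil (id , id)
absorb {m} S T m₀ y l (suc d) m₀∈S m₀-min y∈S y<l l+d≤m gap S⊆T ⊆T T⊆ =
  cons (append⋖ S m₀ x y m₀∈S m₀-min y∈S y<x gap₁)
    (absorb (S ∪ ⁅ x ⁆) T m₀ y l d (x∈p∪q⁺ (inj₁ m₀∈S)) (m₀-min′ ∘ x∈p∪q⁻ S ⁅ x ⁆)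
      (x∈p∪q⁺ (inj₁ y∈S)) y<l (ℕ.<⇒≤ x<m) (gap₂ ∘ x∈p∪q⁻ S ⁅ x ⁆)
      (⊆T₂ ∘ x∈p∪q⁻ S ⁅ x ⁆)
      (λ l≤t t<l+d → ⊆T l≤t (ℕ.<-trans t<l+d l+d<)) (T⊆₂ ∘ T⊆))
  where
  l+d< : l + d < l + suc d
  l+d< = ℕ.≤-reflexive (sym (ℕ.+-suc l d))

  x<m : l + d < m
  x<m = subst (_≤ m) (ℕ.+-suc l d) l+d≤m

  x : Fin m
  x = fromℕ< x<m

  toℕ-x : toℕ x ≡ l + d
  toℕ-x = Finₚ.toℕ-fromℕ< x<m

  y<x : y Fin.< x
  y<x = subst (toℕ y <_) (sym toℕ-x) (ℕ.≤-trans y<l (ℕ.m≤m+n l d))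

  gap₁ : ∀ {s} → s ∈ S → s Fin.≤ y ⊎ x Fin.< s
  gap₁ {s} s∈S = Sum.map₂ (subst (_≤ toℕ s) (trans (ℕ.+-suc l d) (cong suc (sym toℕ-x)))) (gap s∈S)

  m₀-min′ : ∀ {s} → s ∈ S ⊎ s ∈ ⁅ x ⁆ → m₀ Fin.≤ s
  m₀-min′ (inj₁ s∈S) = m₀-min s∈S
  m₀-min′ (inj₂ s∈x) = subst (m₀ Fin.≤_) (sym (x∈⁅y⁆⇒x≡y x s∈x))
                         (ℕ.≤-trans (m₀-min y∈S) (ℕ.<⇒≤ y<x))

  gap₂ : ∀ {s} → s ∈ S ⊎ s ∈ ⁅ x ⁆ → s Fin.≤ y ⊎ l + d ≤ toℕ s
  gap₂ (inj₁ s∈S) = Sum.map₂ (ℕ.≤-trans (ℕ.<⇒≤ l+d<)) (gap s∈S)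
  gap₂ (inj₂ s∈x) = inj₂ (ℕ.≤-reflexive (trans (sym toℕ-x) (cong toℕ (sym (x∈⁅y⁆⇒x≡y x s∈x)))))

  ⊆T₂ : ∀ {t} → t ∈ S ⊎ t ∈ ⁅ x ⁆ → t ∈ T
  ⊆T₂ (inj₁ t∈S) = S⊆T t∈S
  ⊆T₂ (inj₂ t∈x) with x∈⁅y⁆⇒x≡y x t∈x
  ... | refl = ⊆T (subst (l ≤_) (sym toℕ-x) (ℕ.m≤m+n l d)) (subst (_< l + suc d) (sym toℕ-x) l+d<)

  T⊆₂ : ∀ {t} → t ∈ S ⊎ (l ≤ toℕ t × toℕ t < l + suc d) →
        t ∈ S ∪ ⁅ x ⁆ ⊎ (l ≤ toℕ t × toℕ t < l + d)
  T⊆₂ (inj₁ t∈S) = inj₁ (x∈p∪q⁺ (inj₁ t∈S))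
  T⊆₂ {t} (inj₂ (l≤t , t<)) with ℕ.m≤n⇒m<n∨m≡n (ℕ.≤-pred (subst (toℕ t <_) (ℕ.+-suc l d) t<))
  ... | inj₁ t<l+d = inj₂ (l≤t , t<l+d)
  ... | inj₂ t≡l+d = inj₁ (x∈p∪q⁺ (inj₂ (toℕ≡⇒∈⁅⁆ (trans t≡l+d (sym toℕ-x)))))

-- Least and greatest elements of the poset of a set of chains.

module _ {n : ℕ} {S : Pred (List ℕ) 0ℓ} where

  -- All covers of the middle chain lie on one and the same selected maximal chain. In the recursion
  -- a label moves from the middle word to the lower one, so the whole word changes only by
  -- reassociation.
  segment : (x y : Element n S) {ks ls ms : List ℕ} →
            Chain 0̂ (proj₁ x) ks → Chain (proj₁ x) (proj₁ y) ls →
            Chain (proj₁ y) 1̂ ms → S (ks ++ ls ++ ms) → Star (Step n S) x y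
  segment x y cs (nil e) es s = inj₁ e ◅ ε
  segment x@(σ , _) y@(τ , _) {ks} {_} {ms} cs (cons {ρ = ρ} {k = k} {ks = ls} c ds) es s =
    inj₂ (ks , k , ls ++ ms , cs , c , Chain-++ ρ τ 1̂ ds es , s)
    ◅ segment (ρ , ks ++ [ k ] , ls ++ ms , cs′ , Chain-++ ρ τ 1̂ ds es , s′) y cs′ ds es s′
    where
    cs′ : Chain 0̂ ρ (ks ++ [ k ])
    cs′ = Chain-++ 0̂ σ ρ cs (cons c (nil (id , id)))
    s′ : S ((ks ++ [ k ]) ++ ls ++ ms)
    s′ = subst S (sym (++-assoc ks [ k ] (ls ++ ms))) s

  module _ {ws : List ℕ} (cs : Chain {suc n} 0̂ 1̂ ws) (s : S ws) where

    bottom : Element n S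
    bottom = 0̂ , [] , ws , nil (id , id) , cs , s

    top : Element n S
    top = 1̂ , ws , [] , cs , nil (id , id) , subst S (sym (++-identityʳ ws)) s

    -- The chain stored in `x` starts at `0̂` itself, so the comparison runs along that chain and
    -- not along the one that witnesses `bottom`.
    bottom-least : (x : Element n S) → Star (Step n S) bottom x
    bottom-least x@(_ , _ , _ , ds , es , t) = segment bottom x (nil (id , id)) ds es t

    top-greatest : (x : Element n S) → Star (Step n S) x top
    top-greatest x@(_ , ks , ls , ds , es , t) =
      segment x top ds es (nil (id , id)) (subst (S ∘ (ks ++_)) (sym (++-identityʳ ls)) t)

-- Parking functions with at most two values.

-- In sorted order the entries `b` begin at place `p + 1`, so `b` ≤ `p + 1` gives the parking
-- condition for all of them.
two-valued-parking : ∀ p q b {as} → 1 ≤ b → b ≤ suc p →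
                     replicate p 1 ++ replicate q b ↭ as → PF (p + q) as
two-valued-parking p q b 1≤b b≤1+p bs↭as = record
  { length≡n = trans (sym (↭-length bs↭as)) length-bs
  ; positive = All-resp-↭ bs↭as (All.++⁺ (All.replicate⁺ p ℕ.≤-refl) (All.replicate⁺ q 1≤b))
  ; rearrangement = _ , bs↭as , sorted p , bound 0 p b≤1+p
  }
  where
  length-bs : length (replicate p 1 ++ replicate q b) ≡ p + q
  length-bs = trans (length-++ (replicate p 1))
                    (cong₂ _+_ (length-replicate p) (length-replicate q))

  sorted-b : ∀ r → Sorted (replicate r b)
  sorted-b zero          = []
  sorted-b (suc zero)    = [-]
  sorted-b (suc (suc r)) = ℕ.≤-refl ∷ sorted-b (suc r)

  sorted-1b : ∀ r → Sorted (1 ∷ replicate r b)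
  sorted-1b zero    = [-]
  sorted-1b (suc r) = 1≤b ∷ sorted-b (suc r)

  sorted : ∀ r → Sorted (replicate r 1 ++ replicate q b)
  sorted zero          = sorted-b q
  sorted (suc zero)    = sorted-1b q
  sorted (suc (suc r)) = ℕ.≤-refl ∷ sorted (suc r)

  -- `c` counts the ones already passed and `r` those still to come, so `c + r` stays constant.
  bound : ∀ c r → b ≤ suc (c + r) → ∀ i →
          lookup (replicate r 1 ++ replicate q b) i ≤ suc (c + toℕ i)
  bound c (suc r) h zero    = s≤s z≤n
  bound c (suc r) h (suc i) =
    subst (lookup (replicate r 1 ++ replicate q b) i ≤_) (cong suc (sym (ℕ.+-suc c (toℕ i))))
    (bound (suc c) r (subst (b ≤_) (cong suc (ℕ.+-suc c r)) h) i)
  bound c zero    h i = constant q i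
    where
    constant : ∀ r i → lookup (replicate r b) i ≤ suc (c + toℕ i)
    constant (suc r) zero    = h
    constant (suc r) (suc i) = ℕ.≤-trans (constant r i) (s≤s (ℕ.+-monoʳ-≤ c (ℕ.n≤1+n (toℕ i))))

-- Complementary pairs in a direct product.

module _ {e ℓ₁ ℓ₂} (E : Poset e ℓ₁ ℓ₂) where
  private module E = Poset E

  -- The properties of the pair (1 , 0), (0 , 1) in a product of bounded posets
  -- that survive the passage to an isomorphic poset.
  record Complementary (⊥ᴱ ⊤ᴱ u v : E.Carrier) : Set (e ⊔ ℓ₁ ⊔ ℓ₂) where
    field
      atom   : ∀ x → (∀ y → y E.≤ x → y E.≈ ⊥ᴱ ⊎ y E.≈ x) → x E.≤ u ⊎ x E.≤ v
      coatom : ∀ x → (∀ y → x E.≤ y → y E.≈ x ⊎ y E.≈ ⊤ᴱ) → u E.≤ x ⊎ v E.≤ x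
      u≉⊥    : ¬ (u E.≈ ⊥ᴱ)
      v≉⊥    : ¬ (v E.≈ ⊥ᴱ)
      u≉⊤    : ¬ (u E.≈ ⊤ᴱ)
      v≉⊤    : ¬ (v E.≈ ⊤ᴱ)
      u≉v    : ¬ (u E.≈ v)

  Complementary-sym : ∀ {⊥ᴱ ⊤ᴱ u v} → Complementary ⊥ᴱ ⊤ᴱ u v → Complementary ⊥ᴱ ⊤ᴱ v u
  Complementary-sym C = record
    { atom = λ x h → Sum.swap (atom x h) ; coatom = λ x h → Sum.swap (coatom x h)
    ; u≉⊥ = v≉⊥ ; v≉⊥ = u≉⊥ ; u≉⊤ = v≉⊤ ; v≉⊤ = u≉⊤ ; u≉v = u≉v ∘ E.Eq.sym }
    where open Complementary C

module _ {e ℓ₁ ℓ₂ a ℓ₃ ℓ₄ b ℓ₅ ℓ₆}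
         (E : Poset e ℓ₁ ℓ₂) (P : Poset a ℓ₃ ℓ₄) (Q : Poset b ℓ₅ ℓ₆) where
  private
    module E = Poset E
    module P = Poset P
    module Q = Poset Q

  -- The components of the images of `⊥ᴱ` and `⊤ᴱ` are bounds of `P` and `Q`, and `u`, `v` are the
  -- preimages of (1, 0) and (0, 1). The two bounds of each factor differ because the factor has
  -- more than one element.
  product-complements : E ≅ ×-poset P Q → MoreThanOneElement P → MoreThanOneElement Q →
    ∀ {⊥ᴱ ⊤ᴱ} → (∀ x → ⊥ᴱ E.≤ x) → (∀ x → x E.≤ ⊤ᴱ) →
    ∃₂ λ u v → Complementary E ⊥ᴱ ⊤ᴱ u v
  product-complements (f , iso) (p₁ , p₂ , p₁≉p₂) (q₁ , q₂ , q₁≉q₂) {⊥ᴱ} {⊤ᴱ} least greatest =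
    g (1P , 0Q) , g (0P , 1Q) , record
      { atom   = atom
      ; coatom = coatom
      ; u≉⊥ = λ h → P-nontrivial (P.Eq.sym (proj₁ (g-injective h 0≈)))
      ; v≉⊥ = λ h → Q-nontrivial (Q.Eq.sym (proj₂ (g-injective h 0≈)))
      ; u≉⊤ = λ h → Q-nontrivial (proj₂ (g-injective h 1≈))
      ; v≉⊤ = λ h → P-nontrivial (proj₁ (g-injective h 1≈))
      ; u≉v = λ h → P-nontrivial (P.Eq.sym (proj₁ (g-injective h (f∘g (0P , 1Q)))))
      }
    where
    open IsOrderIsomorphism iso using (surjective; mono; cancel) renaming (cong to f-cong)
    module PQ = Poset (×-poset P Q)

    g : PQ.Carrier → E.Carrier
    g y = proj₁ (surjective y)

    f∘g : ∀ y → f (g y) PQ.≈ y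
    f∘g y = proj₂ (surjective y) E.Eq.refl

    0P = proj₁ (f ⊥ᴱ)
    0Q = proj₂ (f ⊥ᴱ)
    1P = proj₁ (f ⊤ᴱ)
    1Q = proj₂ (f ⊤ᴱ)

    0≈ : f ⊥ᴱ PQ.≈ (0P , 0Q)
    0≈ = PQ.Eq.refl
    1≈ : f ⊤ᴱ PQ.≈ (1P , 1Q)
    1≈ = PQ.Eq.refl

    0≤ : ∀ y → (0P , 0Q) PQ.≤ y
    0≤ y = PQ.trans (mono (least (g y))) (PQ.reflexive (f∘g y))

    ≤1 : ∀ y → y PQ.≤ (1P , 1Q)
    ≤1 y = PQ.trans (PQ.reflexive (PQ.Eq.sym (f∘g y))) (mono (greatest (g y)))

    g-injective : ∀ {y x z} → g y E.≈ x → f x PQ.≈ z → y PQ.≈ z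
    g-injective {y} h e = PQ.Eq.trans (PQ.Eq.sym (f∘g y)) (PQ.Eq.trans (f-cong h) e)

    ≤g : ∀ {x y} → f x PQ.≤ y → x E.≤ g y
    ≤g {x} {y} h = cancel (PQ.trans h (PQ.reflexive (PQ.Eq.sym (f∘g y))))

    g≤ : ∀ {x y} → y PQ.≤ f x → g y E.≤ x
    g≤ {x} {y} h = cancel (PQ.trans (PQ.reflexive (f∘g y)) h)

    P-nontrivial : ¬ (0P P.≈ 1P)
    P-nontrivial h = p₁≉p₂ (P.Eq.trans (P.antisym (below p₁) (proj₁ (0≤ (p₁ , 0Q))))
                                        (P.antisym (proj₁ (0≤ (p₂ , 0Q))) (below p₂)))
      where
      below : ∀ p → p P.≤ 0P
      below p = P.trans (proj₁ (≤1 (p , 0Q))) (P.reflexive (P.Eq.sym h))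

    Q-nontrivial : ¬ (0Q Q.≈ 1Q)
    Q-nontrivial h = q₁≉q₂ (Q.Eq.trans (Q.antisym (below q₁) (proj₂ (0≤ (0P , q₁))))
                                        (Q.antisym (proj₂ (0≤ (0P , q₂))) (below q₂)))
      where
      below : ∀ q → q Q.≤ 0Q
      below q = Q.trans (proj₂ (≤1 (0P , q))) (Q.reflexive (Q.Eq.sym h))

    atom : ∀ x → (∀ y → y E.≤ x → y E.≈ ⊥ᴱ ⊎ y E.≈ x) →
           x E.≤ g (1P , 0Q) ⊎ x E.≤ g (0P , 1Q)
    -- If `x` corresponds to (p, q), then (p, 0) lies below it. Either (p, 0) is the bottom, so p =
    -- 0 and `x` is below `v`, or it equals (p, q), so q = 0 and `x` is below `u`.
    atom x h with h (g (proj₁ (f x) , 0Q)) (g≤ (P.refl , proj₂ (0≤ (f x))))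
    ... | inj₁ e = inj₂ (≤g (P.reflexive (proj₁ (g-injective e 0≈)) , proj₂ (≤1 (f x))))
    ... | inj₂ e = inj₁ (≤g (proj₁ (≤1 (f x)) ,
                             Q.reflexive (Q.Eq.sym (proj₂ (g-injective e PQ.Eq.refl)))))

    coatom : ∀ x → (∀ y → x E.≤ y → y E.≈ x ⊎ y E.≈ ⊤ᴱ) →
             g (1P , 0Q) E.≤ x ⊎ g (0P , 1Q) E.≤ x
    -- Dually, (p, 1) lies above (p, q).
    coatom x h with h (g (proj₁ (f x) , 1Q)) (≤g (P.refl , proj₂ (≤1 (f x))))
    ... | inj₁ e = inj₂ (g≤ (proj₁ (0≤ (f x)) , Q.reflexive (proj₂ (g-injective e PQ.Eq.refl))))
    ... | inj₂ e = inj₁ (g≤ (P.reflexive (P.Eq.sym (proj₁ (g-injective e 1≈))) ,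
                             proj₂ (0≤ (f x))))

-- Selected chains through atoms and coatoms.

upper : ∀ m → ℕ → Subset m
upper m k = tabulate λ i → does (k ≤? toℕ i)

∈upper⁺ : ∀ k {i : Fin m} → k ≤ toℕ i → i ∈ upper m k
∈upper⁺ k {i} k≤i = lookup⇒[]= i _ (trans (lookup∘tabulate _ i) (dec-true (k ≤? toℕ i) k≤i))

∈upper⁻ : ∀ k {i : Fin m} → i ∈ upper m k → k ≤ toℕ i
∈upper⁻ k {i} i∈ = decidable-stable (k ≤? toℕ i) λ k≰i →
  contradiction (trans (sym ([]=⇒lookup i∈))
                  (trans (lookup∘tabulate _ i) (dec-false (k ≤? toℕ i) k≰i))) λ ()

-- The block reached halfway along the chains below: the points from `k` on are already in, and the
-- gap above 0 is filled last.
zero∪upper : ∀ n → ℕ → Subset (suc n)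
zero∪upper n k = ⁅ zero ⁆ ∪ upper (suc n) k

zero∈zero∪ : ∀ {n} (S : Subset (suc n)) → zero ∈ ⁅ zero ⁆ ∪ S
zero∈zero∪ S = x∈p∪q⁺ (inj₁ (x∈⁅x⁆ zero))

∈zero∪upper⁻ : ∀ {n} k {i : Fin (suc n)} → i ∈ zero∪upper n k → toℕ i ≡ 0 ⊎ k ≤ toℕ i
∈zero∪upper⁻ {n} k i∈ = Sum.map ∈⁅⁆⇒toℕ≡ (∈upper⁻ k) (x∈p∪q⁻ ⁅ zero ⁆ (upper (suc n) k) i∈)

∈zero∪upper⁺ : ∀ {n} k {i : Fin (suc n)} → toℕ i ≡ 0 ⊎ k ≤ toℕ i → i ∈ zero∪upper n k
∈zero∪upper⁺ k = x∈p∪q⁺ ∘ Sum.map toℕ≡⇒∈⁅⁆ (∈upper⁺ k)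

0⊎positive : ∀ k → k ≡ 0 ⊎ 1 ≤ k
0⊎positive zero    = inj₁ refl
0⊎positive (suc k) = inj₂ (s≤s z≤n)

avoids : {n : ℕ} {ws : List ℕ} → All (n ≢_) ws → ¬ (n List.∈ ws)
avoids = All.All¬⇒¬Any

≡⇒single≈1̂ : ∀ {n} {T : Subset (suc n)} → T ≡ ⊤ → single T ≈ 1̂
≡⇒single≈1̂ refl = single⊤≈1̂

pair : ∀ {n} → Fin n → Subset (suc n)
pair k = ⁅ zero ⁆ ∪ ⁅ suc k ⁆

suc-k+[n∸suc-k]≡n : ∀ {n} (k : Fin n) → suc (toℕ k) + (n ∸ suc (toℕ k)) ≡ n
suc-k+[n∸suc-k]≡n k = ℕ.m+[n∸m]≡n (Finₚ.toℕ<n k)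

-- Counting points from 0, join 0 to k + 1 with label 1, then absorb the `d` points beyond k + 1
-- with label k + 2, then the k points in between with label 1. The word has k + 1 ones and `d`
-- entries k + 2.
OnChain-pair : ∀ {n} (k : Fin n) → 2 ≤ n → n ≢ suc (suc (toℕ k)) →
               OnChain n (PFₙₙ n) (single (pair k))
OnChain-pair {n} k 2≤n n≢ =
  [ 1 ] , replicate d (suc (suc k′)) ++ replicate k′ 1
  , Chain-respˡ 0̂ (single ⁅ zero ⁆) (single (pair k)) (0̂≈single⁅⁆ zero)
      (cons (append⋖ ⁅ zero ⁆ zero (suc k) zero (x∈⁅x⁆ zero) (λ _ → z≤n) (x∈⁅x⁆ zero) (s≤s z≤n)
               (λ s∈ → inj₁ (ℕ.≤-reflexive (∈⁅⁆⇒toℕ≡ s∈))))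
            (nil (id , id)))
  , Chain-++ (single (pair k)) (single (zero∪upper n (suc k′))) 1̂ chain₁
      -- `single ⊤` equals `1̂` only up to `≈`, so an empty chain is appended and its empty word
      -- removed.
      (subst (Chain _ _) (++-identityʳ _)
        (Chain-++ (single (zero∪upper n (suc k′))) (single ⊤) 1̂ chain₂ (nil single⊤≈1̂)))
  , subst (λ r → PF r (1 ∷ replicate d (suc (suc k′)) ++ replicate k′ 1)) k+d≡n
      (two-valued-parking (suc k′) d (suc (suc k′)) (s≤s z≤n) ℕ.≤-refl
        (prep 1 (++-comm (replicate k′ 1) (replicate d (suc (suc k′))))))
  , avoids (n≢1 ∷ All.++⁺ (All.replicate⁺ d n≢) (All.replicate⁺ k′ n≢1))
  where
  k′ = toℕ k
  d  = n ∸ suc k′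
  k+d≡n = suc-k+[n∸suc-k]≡n k

  n≢1 : n ≢ 1
  n≢1 refl = ℕ.<-irrefl refl 2≤n

  pair⁻ : ∀ {i} → i ∈ pair k → toℕ i ≡ 0 ⊎ toℕ i ≡ suc k′
  pair⁻ = Sum.map ∈⁅⁆⇒toℕ≡ ∈⁅⁆⇒toℕ≡ ∘ x∈p∪q⁻ ⁅ zero ⁆ ⁅ suc k ⁆

  chain₁ : Chain (single (pair k)) (single (zero∪upper n (suc k′))) (replicate d (suc (suc k′)))
  chain₁ = absorb (pair k) (zero∪upper n (suc k′)) zero (suc k) (suc (suc k′)) d
    (zero∈zero∪ ⁅ suc k ⁆) (λ _ → z≤n) (x∈p∪q⁺ (inj₂ (x∈⁅x⁆ (suc k)))) ℕ.≤-refl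
    (ℕ.≤-reflexive (cong suc k+d≡n))
    (λ s∈ → inj₁ (Sum.[ (λ e → subst (_≤ suc k′) (sym e) z≤n) , ℕ.≤-reflexive ] (pair⁻ s∈)))
    (∈zero∪upper⁺ (suc k′) ∘ Sum.map₂ (ℕ.≤-reflexive ∘ sym) ∘ pair⁻)
    (λ k<t _ → ∈zero∪upper⁺ (suc k′) (inj₂ (ℕ.<⇒≤ k<t)))
    (λ t∈ → T⊆ (∈zero∪upper⁻ (suc k′) t∈))
    where
    T⊆ : ∀ {t} → toℕ t ≡ 0 ⊎ suc k′ ≤ toℕ t →
         t ∈ pair k ⊎ (suc (suc k′) ≤ toℕ t × toℕ t < suc (suc k′) + d)
    T⊆ (inj₁ e) = inj₁ (x∈p∪q⁺ {q = ⁅ suc k ⁆} (inj₁ (toℕ≡⇒∈⁅⁆ e)))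
    T⊆ {t} (inj₂ k≤t) with ℕ.m≤n⇒m<n∨m≡n k≤t
    ... | inj₁ k<t = inj₂ (k<t , subst (toℕ t <_) (cong suc (sym k+d≡n)) (Finₚ.toℕ<n t))
    ... | inj₂ e   = inj₁ (x∈p∪q⁺ (inj₂ (toℕ≡⇒∈⁅⁆ (sym e))))

  chain₂ : Chain (single (zero∪upper n (suc k′))) (single ⊤) (replicate k′ 1)
  chain₂ = absorb (zero∪upper n (suc k′)) ⊤ zero zero 1 k′
    (zero∈zero∪ (upper (suc n) (suc k′))) (λ _ → z≤n) (zero∈zero∪ (upper (suc n) (suc k′))) ℕ.≤-refl
    (ℕ.m≤n⇒m≤1+n (Finₚ.toℕ<n k))
    (λ {s} s∈ → Sum.map₁ ℕ.≤-reflexive (∈zero∪upper⁻ (suc k′) {s} s∈))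
    (λ _ → ∈⊤) (λ _ _ → ∈⊤) (λ {t} _ → T⊆ t)
    where
    T⊆ : ∀ t → t ∈ zero∪upper n (suc k′) ⊎ (1 ≤ toℕ t × toℕ t < 1 + k′)
    T⊆ t with 0⊎positive (toℕ t) | ℕ.<-≤-connex (toℕ t) (suc k′)
    ... | inj₁ e   | _        = inj₁ (∈zero∪upper⁺ (suc k′) (inj₁ e))
    ... | inj₂ 1≤t | inj₁ t<  = inj₂ (1≤t , t<)
    ... | inj₂ _   | inj₂ k≤t = inj₁ (∈zero∪upper⁺ (suc k′) (inj₂ k≤t))

replicate-++ : ∀ {A : Set} p q {x : A} → replicate p x ++ replicate q x ≡ replicate (p + q) x
replicate-++ zero    q = refl
replicate-++ (suc p) q = cong (_ ∷_) (replicate-++ p q)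

-- From the singleton of 0, absorb the points beyond k + 1 and then those from 1 to k, always with
-- label 1. When k + 1 finally joins, the largest point below it is k, so the last label is k + 1.
OnChain-∁suc : ∀ {n} (k : Fin n) → 2 ≤ n → n ≢ suc (toℕ k) →
               OnChain n (PFₙₙ n) (single (∁ ⁅ suc k ⁆))
OnChain-∁suc {n} k 2≤n n≢ =
  replicate d 1 ++ replicate k′ 1 , [ suc (toℕ (inject₁ k)) ]
  , Chain-respˡ 0̂ (single ⁅ zero ⁆) (single (∁ ⁅ suc k ⁆)) (0̂≈single⁅⁆ zero)
      (Chain-++ (single ⁅ zero ⁆) (single (zero∪upper n (suc (suc k′)))) (single (∁ ⁅ suc k ⁆))
        chain₁ chain₂)
  , cons (append⋖ (∁ ⁅ suc k ⁆) zero (suc k) (inject₁ k)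
            (toℕ≢⇒∈∁⁅⁆ (suc k) λ ()) (λ _ → z≤n) (toℕ≢⇒∈∁⁅⁆ (suc k) k≢suc-k)
            (s≤s (ℕ.≤-reflexive (Finₚ.toℕ-inject₁ k))) gap)
         (nil (≡⇒single≈1̂ (∪-inverseˡ ⁅ suc k ⁆)))
  , subst₂ (λ r ws → PF r (ws ++ [ suc (toℕ (inject₁ k)) ])) d+k+1≡n (sym (replicate-++ d k′))
      (two-valued-parking (d + k′) 1 (suc (toℕ (inject₁ k))) (s≤s z≤n)
        (s≤s (subst (_≤ d + k′) (sym (Finₚ.toℕ-inject₁ k)) (ℕ.m≤n+m k′ d))) ↭-refl)
  , avoids (All.++⁺ (All.++⁺ (All.replicate⁺ d n≢1) (All.replicate⁺ k′ n≢1))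
             ((λ e → n≢ (trans e (cong suc (Finₚ.toℕ-inject₁ k)))) ∷ []))
  where
  k′ = toℕ k
  d  = n ∸ suc k′
  k+d≡n = suc-k+[n∸suc-k]≡n k

  d+k+1≡n : d + k′ + 1 ≡ n
  d+k+1≡n = trans (ℕ.+-comm (d + k′) 1) (trans (cong suc (ℕ.+-comm d k′)) k+d≡n)

  n≢1 : n ≢ 1
  n≢1 refl = ℕ.<-irrefl refl 2≤n

  k≢suc-k : toℕ (inject₁ k) ≢ suc k′
  k≢suc-k e = ℕ.1+n≢n (trans (sym e) (Finₚ.toℕ-inject₁ k))

  gap : ∀ {s} → s ∈ ∁ ⁅ suc k ⁆ → s Fin.≤ inject₁ k ⊎ suc k Fin.< s
  gap {s} s∈ with ℕ.<-cmp (toℕ s) (suc k′)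
  ... | tri< s<k _ _ = inj₁ (subst (toℕ s ≤_) (sym (Finₚ.toℕ-inject₁ k)) (ℕ.≤-pred s<k))
  ... | tri≈ _ e _   = contradiction e (∈∁⁅⁆⇒toℕ≢ s∈)
  ... | tri> _ _ k<s = inj₂ k<s

  chain₁ : Chain (single ⁅ zero ⁆) (single (zero∪upper n (suc (suc k′)))) (replicate d 1)
  chain₁ = absorb ⁅ zero ⁆ (zero∪upper n (suc (suc k′))) zero zero (suc (suc k′)) d
    (x∈⁅x⁆ zero) (λ _ → z≤n) (x∈⁅x⁆ zero) (s≤s z≤n) (ℕ.≤-reflexive (cong suc k+d≡n))
    (λ s∈ → inj₁ (ℕ.≤-reflexive (∈⁅⁆⇒toℕ≡ s∈)))
    (x∈p∪q⁺ {q = upper (suc n) (suc (suc k′))} ∘ inj₁)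
    (λ l≤t _ → ∈zero∪upper⁺ (suc (suc k′)) (inj₂ l≤t))
    (λ {t} t∈ → Sum.map toℕ≡⇒∈⁅⁆
      (λ l≤t → l≤t , subst (toℕ t <_) (cong suc (sym k+d≡n)) (Finₚ.toℕ<n t))
      (∈zero∪upper⁻ (suc (suc k′)) t∈))

  chain₂ : Chain (single (zero∪upper n (suc (suc k′)))) (single (∁ ⁅ suc k ⁆)) (replicate k′ 1)
  chain₂ = absorb (zero∪upper n (suc (suc k′))) (∁ ⁅ suc k ⁆) zero zero 1 k′
    (zero∈zero∪ (upper (suc n) (suc (suc k′)))) (λ _ → z≤n)
    (zero∈zero∪ (upper (suc n) (suc (suc k′)))) ℕ.≤-refl
    (ℕ.m≤n⇒m≤1+n (Finₚ.toℕ<n k))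
    (λ {s} s∈ → Sum.map ℕ.≤-reflexive ℕ.<⇒≤ (∈zero∪upper⁻ (suc (suc k′)) {s} s∈))
    (λ s∈ → toℕ≢⇒∈∁⁅⁆ (suc k) (S≢ (∈zero∪upper⁻ (suc (suc k′)) s∈)))
    (λ _ t<k → toℕ≢⇒∈∁⁅⁆ (suc k) (ℕ.<⇒≢ t<k)) (λ {t} t∈ → T⊆ t (∈∁⁅⁆⇒toℕ≢ t∈))
    where
    S≢ : ∀ {s} → s ≡ 0 ⊎ suc (suc k′) ≤ s → s ≢ suc k′
    S≢ (inj₁ refl) ()
    S≢ (inj₂ k<s)  e = ℕ.<⇒≢ k<s (sym e)

    T⊆ : ∀ t → toℕ t ≢ suc k′ →
         t ∈ zero∪upper n (suc (suc k′)) ⊎ (1 ≤ toℕ t × toℕ t < 1 + k′)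
    T⊆ t t≢ with 0⊎positive (toℕ t) | ℕ.<-cmp (toℕ t) (suc k′)
    ... | inj₁ e   | _            = inj₁ (∈zero∪upper⁺ (suc (suc k′)) (inj₁ e))
    ... | inj₂ 1≤t | tri< t<k _ _ = inj₂ (1≤t , t<k)
    ... | inj₂ _   | tri≈ _ e _   = contradiction e t≢
    ... | inj₂ _   | tri> _ _ k<t = inj₁ (∈zero∪upper⁺ (suc (suc k′)) (inj₂ k<t))

-- From the singleton of 1, the points beyond it are absorbed with label 2, and 0 comes last with
-- label 1. The length is n + 1, so the label 2 is permitted exactly because n is not 1.
OnChain-∁zero : ∀ {n} → 2 ≤ n → OnChain (suc n) (PFₙₙ (suc n)) (single (∁ ⁅ zero ⁆))
OnChain-∁zero {n} 2≤n =
  replicate n 2 , [ 1 ]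
  , Chain-respˡ 0̂ (single ⁅ one ⁆) (single (∁ ⁅ zero ⁆)) (0̂≈single⁅⁆ one) chain
  , cons (prepend⋖ (∁ ⁅ zero ⁆) one zero one∈
            (ℕ.n≢0⇒n>0 ∘ ∈∁⁅⁆⇒toℕ≢))
         (nil (≡⇒single≈1̂ (p∪∁p≡⊤ ⁅ zero ⁆)))
  , two-valued-parking 1 n 2 (s≤s z≤n) ℕ.≤-refl (++-comm [ 1 ] (replicate n 2))
  , avoids (All.++⁺ (All.replicate⁺ n (λ { refl → ℕ.<-irrefl refl 2≤n }))
             ((λ { refl → ℕ.<⇒≱ 2≤n z≤n }) ∷ []))
  where
  one : Fin (suc (suc n))
  one = suc zero

  one∈ : one ∈ ∁ ⁅ zero ⁆
  one∈ = toℕ≢⇒∈∁⁅⁆ zero λ ()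

  chain : Chain (single ⁅ one ⁆) (single (∁ ⁅ zero ⁆)) (replicate n 2)
  chain = absorb ⁅ one ⁆ (∁ ⁅ zero ⁆) one one 2 n
    (x∈⁅x⁆ one) (ℕ.≤-reflexive ∘ sym ∘ ∈⁅⁆⇒toℕ≡) (x∈⁅x⁆ one) ℕ.≤-refl ℕ.≤-refl
    (inj₁ ∘ ℕ.≤-reflexive ∘ ∈⁅⁆⇒toℕ≡)
    (λ s∈ → toℕ≢⇒∈∁⁅⁆ zero (λ e → case-1≡0 (trans (sym (∈⁅⁆⇒toℕ≡ s∈)) e)))
    (λ 2≤t _ → toℕ≢⇒∈∁⁅⁆ zero (λ e → ℕ.<⇒≱ 2≤t (subst (_≤ 1) (sym e) z≤n)))
    (λ {t} t∈ → T⊆ t (∈∁⁅⁆⇒toℕ≢ t∈))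
    where
    case-1≡0 : ¬ (1 ≡ 0)
    case-1≡0 ()

    T⊆ : ∀ t → toℕ t ≢ 0 → t ∈ ⁅ one ⁆ ⊎ (2 ≤ toℕ t × toℕ t < 2 + n)
    T⊆ t t≢0 with ℕ.<-cmp (toℕ t) 1
    ... | tri< t<1 _ _ = contradiction (ℕ.n<1⇒n≡0 t<1) t≢0
    ... | tri≈ _ e _   = inj₁ (toℕ≡⇒∈⁅⁆ e)
    ... | tri> _ _ 1<t = inj₂ (1<t , Finₚ.toℕ<n t)

-- Atoms, coatoms and first merges in the full lattice.

pair-atom : ∀ {n} (k : Fin n) (ρ : NC (suc n)) → ρ ⊑ single (pair k) →
            ρ ≈ 0̂ ⊎ ρ ≈ single (pair k)
pair-atom k ρ ρ⊑ = Sum.map₁ (λ e → ≈-trans ρ (single ⁅ zero ⁆) 0̂ e single≈0̂)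
  (between ⁅ zero ⁆ (pair k) zero (suc k) (x∈⁅x⁆ zero)
    (Sum.map₂ (x∈⁅y⁆⇒x≡y (suc k)) ∘ x∈p∪q⁻ ⁅ zero ⁆ ⁅ suc k ⁆) ρ
    (⊑-trans {σ = single ⁅ zero ⁆} {0̂} {ρ}
      (⊑-reflexive {σ = single ⁅ zero ⁆} {0̂} single≈0̂) (0̂⊑ ρ))
    ρ⊑)
  where
  single≈0̂ : single ⁅ zero ⁆ ≈ 0̂
  single≈0̂ = ≈-sym 0̂ (single ⁅ zero ⁆) (0̂≈single⁅⁆ zero)

-- `s` supplies the point of the large block that `between` asks for.
∁-coatom : ∀ {n} (s x : Fin (suc n)) → s ≢ x → (ρ : NC (suc n)) → single (∁ ⁅ x ⁆) ⊑ ρ →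
           ρ ≈ single (∁ ⁅ x ⁆) ⊎ ρ ≈ 1̂
∁-coatom s x s≢x ρ ⊑ρ = Sum.map₂ (λ e → ≈-trans ρ (single ⊤) 1̂ e single⊤≈1̂)
  (between (∁ ⁅ x ⁆) ⊤ s x (x∉p⇒x∈∁p (x≢y⇒x∉⁅y⁆ s≢x)) (λ {t} _ → split t) ρ ⊑ρ
    (⊑-trans {σ = ρ} {1̂} {single ⊤} (⊑1̂ ρ)
      (⊑-reflexive {σ = 1̂} {single ⊤} (≈-sym (single ⊤) 1̂ single⊤≈1̂))))
  where
  split : ∀ t → t ∈ ∁ ⁅ x ⁆ ⊎ t ≡ x
  split t with t Finₚ.≟ x
  ... | yes t≡x = inj₂ t≡x
  ... | no  t≢x = inj₁ (x∉p⇒x∈∁p (x≢y⇒x∉⁅y⁆ t≢x))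

⊑∁⇒isolated : (x : Fin m) (σ : NC m) → σ ⊑ single (∁ ⁅ x ⁆) → ∀ {j} → Same σ x j → x ≡ j
⊑∁⇒isolated x σ σ⊑ x~j with Same-single⁻ (∁ ⁅ x ⁆) (⊑⇒Same σ (single (∁ ⁅ x ⁆)) σ⊑ x~j)
... | inj₁ x≡j      = x≡j
... | inj₂ (x∈ , _) = contradiction (x∈⁅x⁆ x) (x∈∁p⇒x∉p x∈)

Same-pair : ∀ {n} (k : Fin n) (σ : NC (suc n)) → single (pair k) ⊑ σ → Same σ zero (suc k)
Same-pair k σ ⊑σ = ⊑⇒Same (single (pair k)) σ ⊑σ
  (Same-single⁺ (pair k) (zero∈zero∪ ⁅ suc k ⁆) (x∈p∪q⁺ {p = ⁅ zero ⁆} (inj₂ (x∈⁅x⁆ (suc k)))))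

-- The first cover above `0̂` merges two singletons, so its label names the smaller of two points,
-- and these remain joined all the way up to `σ`. Forbidding a label thus forbids a smaller point.
first-merge : (σ : NC m) {ks : List ℕ} → Chain 0̂ σ ks →
              0̂ ≈ σ ⊎ (∃₂ λ i j → i Fin.< j × Same σ i j × suc (toℕ i) List.∈ ks)
first-merge σ (nil e) = inj₁ e
first-merge σ (cons {ρ = ρ} (_ , M) cs) = inj₂ (max₁ , j , max₁<B₂ j∈B₂ ,
  ⊑⇒Same ρ σ (Chain⇒⊑ ρ σ cs)
    (B₁ ∪ B₂ , merged , x∈p∪q⁺ (inj₁ max₁∈B₁) , x∈p∪q⁺ (inj₂ j∈B₂)) ,
  here (sym label≡))
  where
  open Merge M
  j    = proj₁ (NC.nonempty 0̂ B₂-block)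
  j∈B₂ = proj₂ (NC.nonempty 0̂ B₂-block)

-- The case of length at least 3.

module LargeCase {n} (2≤n : 2 ≤ n) {ws : List ℕ} (cs : Chain {suc (suc n)} 0̂ 1̂ ws)
                 (s : PFₙₙ (suc n) ws) where
  -- The length in the theorem, here at least 3; the points are 0 to `N`.
  N : ℕ
  N = suc n

  E : Poset _ _ _
  E = PosetPFₙₙ N

  El : Set₁
  El = Element N (PFₙₙ N)

  module E = Poset E

  ⊥ᴱ ⊤ᴱ : El
  ⊥ᴱ = bottom cs s
  ⊤ᴱ = top cs s

  2≤N : 2 ≤ N
  2≤N = ℕ.m≤n⇒m≤1+n 2≤n

  to⊑ : {x y : El} → x E.≤ y → proj₁ x ⊑ proj₁ y
  to⊑ = star⇒⊑ N (PFₙₙ N)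

  -- The order of the poset is contained in refinement, so a coatom of the full lattice that belongs
  -- to the poset is a coatom there too. The same holds for atoms.
  ∁-coatomᴱ : (s x : Fin (suc N)) → s ≢ x → (c : OnChain N (PFₙₙ N) (single (∁ ⁅ x ⁆))) →
              ∀ y → (single (∁ ⁅ x ⁆) , c) E.≤ y →
              y E.≈ (single (∁ ⁅ x ⁆) , c) ⊎ y E.≈ ⊤ᴱ
  ∁-coatomᴱ s x s≢x c y@(ρ , _) h =
    ∁-coatom s x s≢x ρ (to⊑ {_ , c} {y} h)

  pair-atomᴱ : (k : Fin N) (c : OnChain N (PFₙₙ N) (single (pair k))) →
               ∀ y → y E.≤ (single (pair k) , c) → y E.≈ ⊥ᴱ ⊎ y E.≈ (single (pair k) , c)
  pair-atomᴱ k c y@(ρ , _) h =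
    pair-atom k ρ (to⊑ {y} {_ , c} h)

  module _ (u v : El) (C : Complementary E ⊥ᴱ ⊤ᴱ u v)
           (v⊑ : proj₁ v ⊑ single (∁ ⁅ zero ⁆)) where
    open Complementary C

    private
      σ τ : NC (suc N)
      σ = proj₁ u
      τ = proj₁ v

    -- The atom joining 0 to k + 1 is not below `v`, where 0 is isolated, so it is below `u`. The
    -- coatom isolating k + 1 is then not above `u`, hence above `v`. The two hypotheses on `k` are
    -- what puts this atom and this coatom on selected chains.
    suc-isolated : (k : Fin N) → N ≢ suc (suc (toℕ k)) → N ≢ suc (toℕ k) →
                   ∀ {j} → Same τ (suc k) j → suc k ≡ j
    suc-isolated k ≢2+k ≢1+k = cases
      (atom (single (pair k) , p) (pair-atomᴱ k p))
      (coatom (single (∁ ⁅ suc k ⁆) , c) (∁-coatomᴱ zero (suc k) (λ ()) c))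
      where
      p = OnChain-pair k 2≤N ≢2+k
      c = OnChain-∁suc k 2≤N ≢1+k

      cases : (single (pair k) , p) E.≤ u ⊎ (single (pair k) , p) E.≤ v →
              u E.≤ (single (∁ ⁅ suc k ⁆) , c) ⊎ v E.≤ (single (∁ ⁅ suc k ⁆) , c) →
              ∀ {j} → Same τ (suc k) j → suc k ≡ j
      cases (inj₂ p≤v) _ =
        contradiction (⊑∁⇒isolated zero τ v⊑ (Same-pair k τ (to⊑ {_} {v} p≤v))) λ ()
      cases (inj₁ p≤u) (inj₁ u≤c) =
        contradiction (⊑∁⇒isolated (suc k) σ (to⊑ {u} {_} u≤c)
                        (Same-sym σ (Same-pair k σ (to⊑ {_} {u} p≤u)))) λ ()
      cases (inj₁ _) (inj₂ v≤c) = ⊑∁⇒isolated (suc k) τ (to⊑ {v} {_} v≤c)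

    -- The first merge below `v` has a smaller point. It is not among 0 to N - 2, which are isolated
    -- in `v`, nor N - 1, whose label `N` is forbidden, nor the last point `N`.
    contradictory : ⊥
    contradictory with first-merge τ (proj₁ (proj₂ (proj₂ (proj₂ v))))
    ... | inj₁ 0̂≈τ = v≉⊥ (≈-sym 0̂ τ 0̂≈τ)
    ... | inj₂ (zero , j , i<j , i~j , _) = Finₚ.<⇒≢ i<j (⊑∁⇒isolated zero τ v⊑ i~j)
    ... | inj₂ (suc k , j , i<j , i~j , ∈ks) with N ℕ.≟ suc (suc (toℕ k))
    ...   | yes N≡ = proj₂ (proj₂ (proj₂ (proj₂ (proj₂ (proj₂ v)))))
                       (∈-++⁺ˡ (subst (List._∈ proj₁ (proj₂ v)) (sym N≡) ∈ks))
    -- The last point is never the smaller of a pair, which gives the second hypothesis of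
    -- `suc-isolated`.
    ...   | no  N≢ = Finₚ.<⇒≢ i<j (suc-isolated k N≢
              (λ N≡ → ℕ.<-irrefl (sym N≡) (ℕ.≤-trans i<j (ℕ.≤-pred (Finₚ.toℕ<n j)))) i~j)

  irreducible : ∀ u v → ¬ Complementary E ⊥ᴱ ⊤ᴱ u v
  irreducible u v C
    with Complementary.coatom C (single (∁ ⁅ zero ⁆) , OnChain-∁zero 2≤n)
           (∁-coatomᴱ (suc zero) zero (λ ()) (OnChain-∁zero 2≤n))
  -- The situation is symmetric in `u` and `v`.
  ... | inj₁ u≤d = contradictory v u (Complementary-sym E C) (to⊑ {u} {_} u≤d)
  ... | inj₂ v≤d = contradictory u v C (to⊑ {v} {_} v≤d)

-- The case of length 2.

-- The only parking function of length 2 without the entry 2 is (1, 1), so there is a single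
-- selected chain. Its middle element joins 0 and 2.
two-middle : (x : Element 2 (PFₙₙ 2)) → ¬ (proj₁ x ≈ 0̂) → ¬ (proj₁ x ≈ 1̂) →
             proj₁ x ≈ single (∁ ⁅ suc zero ⁆)
two-middle (σ , ks , ls , cs , ds , _ , 2∉) σ≉0̂ σ≉1̂ =
  Sum.[ id , (λ e → contradiction e σ≉1̂) ]
    (∁-coatom zero (suc zero) (λ ()) σ (single⊑ (∁ ⁅ suc zero ⁆) σ zero 0~))
  where
  -- If 0 and 1 were joined, the next cover would add 2 to their block, and the largest point below
  -- 2 would be 1, giving the forbidden label 2.
  0≁1 : ∀ {ls} → ¬ (2 List.∈ ls) → Chain σ 1̂ ls → ¬ Same σ zero (suc zero)
  0≁1 _ (nil e) _ = σ≉1̂ e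
  0≁1 2∉ls (cons (_ , M) _) (B , p , 0∈B , 1∈B) = cases max₁ refl
    where
    open Merge M

    cases : ∀ i → i ≡ max₁ → ⊥
    -- The block of 0 also contains 1, so `B₂` avoids both and lies beyond 1, against the maximality
    -- of `max₁`.
    cases zero refl = ℕ.<⇒≱ {0} {1} (s≤s z≤n) (max₁-max 1∈B₁ 1<B₂)
      where
      1∈B₁ : suc zero ∈ B₁
      1∈B₁ = subst (suc zero ∈_) (NC.disjoint σ p B₁-block 0∈B max₁∈B₁) 1∈B

      1<B₂ : Below B₂ (suc zero)
      1<B₂ {zero} 0∈B₂ = contradiction (NC.disjoint σ B₁-block B₂-block max₁∈B₁ 0∈B₂) B₁≢B₂
      1<B₂ {suc zero} 1∈B₂ = contradiction (NC.disjoint σ B₁-block B₂-block 1∈B₁ 1∈B₂) B₁≢B₂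
      1<B₂ {suc (suc zero)} _ = s≤s (s≤s z≤n)
    cases (suc zero) e = 2∉ls (here (sym (trans label≡ (cong (suc ∘ toℕ) (sym e)))))
    cases (suc (suc zero)) refl with NC.nonempty σ B₂-block
    ... | j , j∈B₂ = ℕ.<⇒≱ (max₁<B₂ j∈B₂) (ℕ.≤-pred (Finₚ.toℕ<n j))

  0~2 : Same σ zero (suc (suc zero))
  0~2 with first-merge σ cs
  ... | inj₁ e = contradiction (≈-sym 0̂ σ e) σ≉0̂
  ... | inj₂ (zero , zero , () , _)
  ... | inj₂ (zero , suc zero , _ , 0~1 , _) = contradiction 0~1 (0≁1 (2∉ ∘ ∈-++⁺ʳ ks) ds)
  ... | inj₂ (zero , suc (suc zero) , _ , 0~2 , _) = 0~2
  ... | inj₂ (suc zero , _ , _ , _ , 2∈ks) = contradiction (∈-++⁺ˡ 2∈ks) 2∉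
  ... | inj₂ (suc (suc zero) , j , 2<j , _) = contradiction (ℕ.≤-pred (Finₚ.toℕ<n j)) (ℕ.<⇒≱ 2<j)

  0~ : ∀ {i} → i ∈ ∁ ⁅ suc zero ⁆ → Same σ zero i
  0~ {zero}           _  = Same-refl σ zero
  0~ {suc zero}       i∈ = contradiction refl (∈∁⁅⁆⇒toℕ≢ i∈)
  0~ {suc (suc zero)} _  = 0~2

-- Existence of a selected maximal chain, and the conclusion.

maximal-chain-through : ∀ {n} {S : Pred (List ℕ) 0ℓ} {σ : NC (suc n)} → OnChain n S σ →
                        ∃ λ ws → Chain {suc n} 0̂ 1̂ ws × S ws
maximal-chain-through {σ = σ} (ks , ls , cs , ds , s) = ks ++ ls , Chain-++ 0̂ σ 1̂ cs ds , s

maximal-chain : ∀ n → 2 ≤ n → ∃ λ ws → Chain {suc n} 0̂ 1̂ ws × PFₙₙ n ws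
maximal-chain (suc zero)    (s≤s ())
maximal-chain (suc (suc n)) 2≤n =
  -- With k = 0 the chain through this coatom has all its labels equal to 1.
  maximal-chain-through {σ = single (∁ ⁅ suc zero ⁆)} (OnChain-∁suc zero 2≤n λ ())

proposition2p6 : ∀ (n : ℕ) → 2 ≤ n →
    ∀ {a ℓ₁ ℓ₂ b ℓ₃ ℓ₄} (P : Poset a ℓ₁ ℓ₂) (Q : Poset b ℓ₃ ℓ₄) →
    MoreThanOneElement P → MoreThanOneElement Q →
    ¬ (PosetPFₙₙ n ≅ ×-poset P Q)
proposition2p6 n 2≤n P Q P>1 Q>1 iso
  with maximal-chain n 2≤n
... | ws , cs , s
  with product-complements (PosetPFₙₙ n) P Q iso P>1 Q>1 (bottom-least cs s) (top-greatest cs s)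
... | u , v , C with ℕ.m≤n⇒m<n∨m≡n 2≤n
...   | inj₁ (s≤s 2≤n-1) =
        LargeCase.irreducible 2≤n-1 cs s u v C
...   | inj₂ refl = u≉v (≈-trans (proj₁ u) (single (∁ ⁅ suc zero ⁆)) (proj₁ v)
          (two-middle u u≉⊥ u≉⊤)
          (≈-sym (proj₁ v) (single (∁ ⁅ suc zero ⁆)) (two-middle v v≉⊥ v≉⊤)))
  where open Complementary C
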